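{- For all $k\geq2$, the DCell $D_{k,2}$ is super-$\lambda_3$: every minimum $3$-restricted edge-cut $F$ of $D_{k,2}$ is such that $D_{k,2}-F$ has a component that is a connected subgraph on exactly three vertices.
   Context: DCell $D_{k,n}$ ($n\geq 2$, $k\geq 0$) is defined recursively. $D_{0,n}$ is the complete graph $K_n$ on vertices $0,1,\dots,n-1$. Let $t_{k,n}=|V(D_{k,n})|$. For $k\geq1$, $D_{k,n}$ is built from $t_{k-1,n}+1$ disjoint copies $D^0_{k-1,n},\dots,D^{t_{k-1,n}}_{k-1,n}$ of $D_{k-1,n}$; a vertex of copy $D^i_{k-1,n}$ is labeled $(i,a_{k-1},\dots,a_0)$, where $(a_{k-1},\dots,a_0)$ is its label in $D_{k-1,n}$, and its index within the copy is $uid_{k-1}=a_0+\sum_{l=1}^{k-1}a_l t_{l-1,n}$. For each pair $a<b$ of copy indices, one edge joins the vertex of $D^a_{k-1,n}$ with $uid_{k-1}=b-1$ to the vertex of $D^b_{k-1,n}$ with $uid_{k-1}=a$. An edge set $F$ is an $m$-restricted edge-cut of $G$ if $G-F$ is disconnected and every component has at least $m$ vertices; $G$ is super-$\lambda_m$ if every minimum $m$-restricted edge-cut isolates a connected subgraph on exactly $m$ vertices. -}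

module Defs where

open import Data.Nat using (ℕ; zero; suc; _+_; _*_; _∸_; _≤_; _<ᵇ_; _≡ᵇ_)
open import Data.Fin using (Fin; toℕ)
open import Data.Fin.Properties using () renaming (_≟_ to _≟ᶠ_)
open import Data.Bool using (Bool; true; false; _∧_; _∨_; not; if_then_else_; T)
open import Data.Bool.Properties using (T?)
open import Data.Product using (Σ; _×_; _,_; ∃)
open import Data.List using (List; []; _∷_; length; filter; cartesianProduct; allFin)
open import Data.List.Relation.Unary.All using (All)
open import Data.List.Relation.Unary.Unique.Propositional using (Unique)
open import Data.List.Membership.Propositional using (_∈_)
open import Relation.Binary.PropositionalEquality using (_≡_)
open import Relation.Nullary using (¬_)
open import Relation.Nullary.Decidable using (⌊_⌋)

-- t k n = |V(D_{k,n})|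
t : ℕ → ℕ → ℕ
t zero    n = n
t (suc k) n = t k n * (suc (t k n))

-- Vertices of D_{k,n}: D_{0,n} has vertices Fin n; a vertex of D_{k+1,n}
-- is (i , u) with i the copy index in {0..t k n} and u a vertex of D_{k,n}.
V : ℕ → ℕ → Set
V zero    n = Fin n
V (suc k) n = Fin (suc (t k n)) × V k n

uid : (k n : ℕ) → V k n → ℕ
uid zero    n i       = toℕ i
uid (suc k) n (i , u) = toℕ i * t k n + uid k n u

adj : (k n : ℕ) → V k n → V k n → Bool
adj zero    n i j = not ⌊ i ≟ᶠ j ⌋
adj (suc k) n (a , u) (b , v) =
  if ⌊ a ≟ᶠ b ⌋ then adj k n u v
  else ( ((toℕ a <ᵇ toℕ b) ∧ (uid k n u ≡ᵇ (toℕ b ∸ 1)) ∧ (uid k n v ≡ᵇ toℕ a))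
       ∨ ((toℕ b <ᵇ toℕ a) ∧ (uid k n v ≡ᵇ (toℕ a ∸ 1)) ∧ (uid k n u ≡ᵇ toℕ b)))

allV : (k n : ℕ) → List (V k n)
allV zero    n = allFin n
allV (suc k) n = cartesianProduct (allFin (suc (t k n))) (allV k n)

-- An edge set F is given by a Boolean marking of vertex pairs; the edge
-- {u,v} of D_{k,n} belongs to F iff F u v or F v u is true.
EdgeSet : ℕ → ℕ → Set
EdgeSet k n = V k n → V k n → Bool

inF : (k n : ℕ) → EdgeSet k n → V k n → V k n → Bool
inF k n F u v = adj k n u v ∧ (F u v ∨ F v u)

-- |F| : number of edges {u,v} of D_{k,n} in F (each counted once, uid u < uid v)
card : (k n : ℕ) → EdgeSet k n → ℕ
card k n F = length (filter (λ p → T? (marked p))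
                            (cartesianProduct (allV k n) (allV k n)))
  where
  marked : V k n × V k n → Bool
  marked (u , v) = (uid k n u <ᵇ uid k n v) ∧ inF k n F u v

EdgeMinus : (k n : ℕ) → EdgeSet k n → V k n → V k n → Set
EdgeMinus k n F u v = (adj k n u v ∧ not (F u v ∨ F v u)) ≡ true

data Reach (k n : ℕ) (F : EdgeSet k n) (u : V k n) : V k n → Set where
  here : Reach k n F u u
  step : ∀ {v w} → Reach k n F u v → EdgeMinus k n F v w → Reach k n F u w

CompAtLeast : (k n : ℕ) → EdgeSet k n → ℕ → V k n → Set
CompAtLeast k n F m u =
  Σ (List (V k n)) λ xs → Unique xs × All (Reach k n F u) xs × m ≤ length xs

CompExactly : (k n : ℕ) → EdgeSet k n → ℕ → V k n → Set
CompExactly k n F m u =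
  Σ (List (V k n)) λ xs → Unique xs × All (Reach k n F u) xs × length xs ≡ m
    × (∀ w → Reach k n F u w → w ∈ xs)

IsRestrictedCut : (k n m : ℕ) → EdgeSet k n → Set
IsRestrictedCut k n m F =
  (∃ λ (p : V k n × V k n) → let (u , v) = p in ¬ Reach k n F u v)
  × (∀ u → CompAtLeast k n F m u)

IsMinRestrictedCut : (k n m : ℕ) → EdgeSet k n → Set
IsMinRestrictedCut k n m F =
  IsRestrictedCut k n m F × (∀ F′ → IsRestrictedCut k n m F′ → card k n F ≤ card k n F′)

SuperLambda : (k n m : ℕ) → Set
SuperLambda k n m =
  ∀ F → IsMinRestrictedCut k n m F → ∃ λ u → CompExactly k n F m u

-- Orient every boundary edge of a vertex set X from X outwards, and split it along the
-- t + 1 copies of D_{k,2} in D_{k+1,2}: the edges inside the copies, plus exactly one edge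
-- between any two copies. By induction on k, |∂X| ≥ 3k whenever X and its complement have
-- at least 4 vertices: if some copy lies in X and another misses X, every other copy
-- contributes an edge and |∂X| ≥ t; if no copy lies in X, then three copies meeting X
-- already give 3k inner edges, while if only one or two meet X then, apart from the edge
-- joining these two, all edges leaving them from X are in ∂X. Passing to the complement
-- exchanges the last case with its dual; D_{1,2} is the 6-cycle. On the other hand the
-- boundary of a path on 3 vertices is a 3-restricted cut with 3k − 1 edges. So if F is a
-- minimum cut and X a component of the rest, X or its complement has at most 3 vertices,
-- and hence is a component on exactly 3.
module Submission where

open import Defs
open import Data.Bool using (Bool; true; false; _∧_; _∨_; not; if_then_else_; T)
open import Data.Bool.Properties using (T?; T-≡; T-∧; ∨-comm; ∨-zeroʳ; ∧-comm; ∧-identityʳ; ∧-conicalˡ; ∧-conicalʳ; ∧-inverseʳ; ∧-zeroʳ; ∨-identityʳ; not-involutive; not-injective) renaming (_≟_ to _≟ᵇ_)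
open import Data.Fin using (Fin; zero; suc; toℕ; punchIn; fromℕ<; combine)
open import Data.Fin.Properties using (toℕ<n; toℕ-injective; toℕ-fromℕ<; fromℕ<-injective; punchIn-injective; punchInᵢ≢i; any?) renaming (_≟_ to _≟ᶠ_)
open import Data.List using (List; []; _∷_; _++_; length; map; filter; cartesianProduct; allFin)
open import Data.List.Properties using (length-tabulate; map-tabulate; length-map)
open import Data.List.Membership.Propositional using (_∈_)
open import Data.List.Membership.Propositional.Properties using (∈-∃++; ∈-filter⁺; ∈-filter⁻; ∈-allFin; ∈-cartesianProduct⁺)
open import Data.List.Relation.Unary.Any using (here; there)
open import Data.List.Relation.Unary.All using (All; []; _∷_)
import Data.List.Relation.Unary.All as All
import Data.List.Relation.Unary.All.Properties as All
open import Data.List.Relation.Unary.AllPairs using ([]; _∷_)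
open import Data.List.Relation.Unary.Unique.Propositional using (Unique)
import Data.List.Relation.Unary.Unique.Propositional.Properties as Unique
open import Data.List.Relation.Binary.Permutation.Propositional using (_↭_; refl; prep; swap; trans)
open import Data.List.Relation.Binary.Permutation.Propositional.Properties using (shift; ∈-resp-↭)
open import Data.Nat
open import Data.Nat.DivMod
open import Data.Nat.Properties
open import Data.Nat.Tactic.RingSolver using (solve-∀)
open import Data.Product using (_×_; _,_; proj₁; proj₂; ∃)
open import Data.Sum using (_⊎_; inj₁; inj₂; [_,_]′)
open import Data.Vec using (Vec; []; _∷_; lookup)
open import Function using (_∘_; id)
open import Function.Bundles using (Equivalence)
open import Relation.Binary.Definitions using (tri<; tri≈; tri>)
open import Relation.Binary.PropositionalEquality hiding (trans)
import Relation.Binary.PropositionalEquality as ≡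
open import Relation.Nullary using (¬_; Dec; yes; no; contradiction)
open import Relation.Nullary.Decidable using (⌊_⌋; map′; _×-dec_; _⊎-dec_; toWitness; fromWitness)

private variable
  A B : Set

-- Finite sums over lists

∑ : List A → (A → ℕ) → ℕ
∑ []       f = 0
∑ (x ∷ xs) f = f x + ∑ xs f

⟦_⟧ : Bool → ℕ
⟦ true ⟧  = 1
⟦ false ⟧ = 0

⟦⟧≤1 : ∀ b → ⟦ b ⟧ ≤ 1
⟦⟧≤1 true  = ≤-refl
⟦⟧≤1 false = z≤n

∑-mono-∈ : ∀ {f g : A → ℕ} xs → (∀ {x} → x ∈ xs → f x ≤ g x) → ∑ xs f ≤ ∑ xs g
∑-mono-∈ []       f≤g = z≤n
∑-mono-∈ (x ∷ xs) f≤g = +-mono-≤ (f≤g (here refl)) (∑-mono-∈ xs (f≤g ∘ there))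

∑-mono : ∀ {f g : A → ℕ} xs → (∀ x → f x ≤ g x) → ∑ xs f ≤ ∑ xs g
∑-mono xs f≤g = ∑-mono-∈ xs (λ {x} _ → f≤g x)

∑-cong : ∀ {f g : A → ℕ} xs → (∀ x → f x ≡ g x) → ∑ xs f ≡ ∑ xs g
∑-cong []       f≡g = refl
∑-cong (x ∷ xs) f≡g = cong₂ _+_ (f≡g x) (∑-cong xs f≡g)

∑-const : ∀ (xs : List A) c → ∑ xs (λ _ → c) ≡ length xs * c
∑-const []       c = refl
∑-const (x ∷ xs) c = cong (c +_) (∑-const xs c)

∑-0 : ∀ (xs : List A) → ∑ xs (λ _ → 0) ≡ 0
∑-0 xs = ≡.trans (∑-const xs 0) (*-zeroʳ (length xs))

∑-distrib-+ : ∀ (f g : A → ℕ) xs → ∑ xs (λ x → f x + g x) ≡ ∑ xs f + ∑ xs g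
∑-distrib-+ f g []       = refl
∑-distrib-+ f g (x ∷ xs) rewrite ∑-distrib-+ f g xs = lemma (f x) (g x) (∑ xs f) (∑ xs g)
  where
  lemma : ∀ a b c d → a + b + (c + d) ≡ a + c + (b + d)
  lemma = solve-∀

∑-swap : ∀ (f : A → B → ℕ) xs ys →
         ∑ xs (λ x → ∑ ys (f x)) ≡ ∑ ys (λ y → ∑ xs (λ x → f x y))
∑-swap f []       ys = sym (∑-0 ys)
∑-swap f (x ∷ xs) ys rewrite ∑-swap f xs ys = sym (∑-distrib-+ (f x) _ ys)

∑-++ : ∀ (f : A → ℕ) xs ys → ∑ (xs ++ ys) f ≡ ∑ xs f + ∑ ys f
∑-++ f []       ys = refl
∑-++ f (x ∷ xs) ys rewrite ∑-++ f xs ys = sym (+-assoc (f x) _ _)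

∑-map : ∀ (g : A → B) (f : B → ℕ) xs → ∑ (map g xs) f ≡ ∑ xs (f ∘ g)
∑-map g f []       = refl
∑-map g f (x ∷ xs) = cong (f (g x) +_) (∑-map g f xs)

∑-× : ∀ (f : A × B → ℕ) xs ys →
      ∑ (cartesianProduct xs ys) f ≡ ∑ xs (λ x → ∑ ys (λ y → f (x , y)))
∑-× f []       ys = refl
∑-× f (x ∷ xs) ys = ≡.trans (∑-++ f (map (x ,_) ys) _) (cong₂ _+_ (∑-map (x ,_) f ys) (∑-× f xs ys))

∑-↭ : ∀ (f : A → ℕ) {xs ys} → xs ↭ ys → ∑ xs f ≡ ∑ ys f
∑-↭ f refl         = refl
∑-↭ f (prep x p)   = cong (f x +_) (∑-↭ f p)
∑-↭ f (swap {xs} {ys} x y p) rewrite ∑-↭ f p = begin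
    f x + (f y + ∑ ys f) ≡⟨ +-assoc (f x) (f y) _ ⟨
    f x + f y + ∑ ys f   ≡⟨ cong (_+ ∑ ys f) (+-comm (f x) (f y)) ⟩
    f y + f x + ∑ ys f   ≡⟨ +-assoc (f y) (f x) _ ⟩
    f y + (f x + ∑ ys f) ∎
  where open ≡-Reasoning
∑-↭ f (trans p q)  = ≡.trans (∑-↭ f p) (∑-↭ f q)

length-∑ : ∀ (xs : List A) → length xs ≡ ∑ xs (λ _ → 1)
length-∑ xs = sym (≡.trans (∑-const xs 1) (*-identityʳ _))

length-filter-T? : ∀ (p : A → Bool) xs → length (filter (T? ∘ p) xs) ≡ ∑ xs (⟦_⟧ ∘ p)
length-filter-T? p []       = refl
length-filter-T? p (x ∷ xs) with p x
... | true  = cong suc (length-filter-T? p xs)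
... | false = length-filter-T? p xs

extract : ∀ {x : A} {xs} → x ∈ xs → ∃ λ ys → xs ↭ x ∷ ys
extract x∈xs with ys , zs , refl ← ∈-∃++ x∈xs = ys ++ zs , shift _ ys zs

-- By induction on `xs`: the head is extracted from `ys`, and since `xs` has no repetition its tail
-- embeds in what remains.
∑-⊆ : ∀ (f : A → ℕ) {xs ys} → Unique xs → (∀ {x} → x ∈ xs → x ∈ ys) → ∑ xs f ≤ ∑ ys f
∑-⊆ f {[]}     uniq sub = z≤n
∑-⊆ f {x ∷ xs} (x∉ ∷ uniq) sub with zs , ys↭ ← extract (sub (here refl)) =
  ≤-trans (+-monoʳ-≤ (f x) (∑-⊆ f uniq sub′)) (≤-reflexive (sym (∑-↭ f ys↭)))
  where
  sub′ : ∀ {y} → y ∈ xs → y ∈ zs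
  sub′ y∈ with ∈-resp-↭ ys↭ (sub (there y∈))
  ... | here refl = contradiction refl (All.lookup x∉ y∈)
  ... | there y∈zs = y∈zs

∑-reindex : ∀ {f : A → ℕ} {g : B → ℕ} {xs ys} (π : A → B) → (∀ {x y} → π x ≡ π y → x ≡ y) →
            Unique xs → (∀ y → y ∈ ys) → (∀ x → f x ≤ g (π x)) → ∑ xs f ≤ ∑ ys g
∑-reindex {f = f} {g} {xs} {ys} π inj uniq all f≤g = begin
  ∑ xs f         ≤⟨ ∑-mono xs f≤g ⟩
  ∑ xs (g ∘ π)   ≡⟨ ∑-map π g xs ⟨
  ∑ (map π xs) g ≤⟨ ∑-⊆ g (Unique.map⁺ inj uniq) (λ _ → all _) ⟩
  ∑ ys g         ∎
  where open ≤-Reasoning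

∑-⟦⟧≤1 : ∀ (p : A → Bool) {xs} → Unique xs → (∀ {x y} → p x ≡ true → p y ≡ true → x ≡ y) →
         ∑ xs (⟦_⟧ ∘ p) ≤ 1
∑-⟦⟧≤1 p [] one = z≤n
∑-⟦⟧≤1 p {x ∷ xs} (x∉ ∷ uniq) one with p x in px
... | false = ∑-⟦⟧≤1 p uniq one
... | true  = s≤s (≤-reflexive (≡.trans (rest xs x∉) (∑-0 xs)))
  where
  rest : ∀ ys → All (x ≢_) ys → ∑ ys (⟦_⟧ ∘ p) ≡ ∑ ys (λ _ → 0)
  rest []       []          = refl
  rest (y ∷ ys) (x≢y ∷ x∉ys) with p y in py
  ... | true  = contradiction (one px py) x≢y
  ... | false = rest ys x∉ys

∑-term : ∀ (f : A → ℕ) {x xs} → x ∈ xs → f x ≤ ∑ xs f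
∑-term f (here refl)    = m≤m+n _ _
∑-term f (there x∈)     = ≤-trans (∑-term f x∈) (m≤n+m _ _)

-- Confines the corrections `c` and `d` to one exceptional index, such as the diagonal of a row or
-- the edge joining two given copies.
∑-mono-at : ∀ {f g : A → ℕ} {c d x xs} → x ∈ xs → Unique xs → c + f x ≤ d + g x →
            (∀ {y} → y ≢ x → f y ≤ g y) → c + ∑ xs f ≤ d + ∑ xs g
∑-mono-at {f = f} {g} {c} {d} {x} {_ ∷ xs} (here refl) (x∉ ∷ _) at off = begin
  c + (f x + ∑ xs f) ≡⟨ +-assoc c _ _ ⟨
  c + f x + ∑ xs f   ≤⟨ +-mono-≤ at (∑-mono-∈ xs (λ y∈ → off (λ y≡x → All.lookup x∉ y∈ (sym y≡x)))) ⟩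
  d + g x + ∑ xs g   ≡⟨ +-assoc d _ _ ⟩
  d + (g x + ∑ xs g) ∎
  where open ≤-Reasoning
∑-mono-at {f = f} {g} {c} {d} {x} {y ∷ xs} (there x∈) (y∉ ∷ uniq) at off = begin
  c + (f y + ∑ xs f) ≡⟨ exchange c (f y) (∑ xs f) ⟩
  f y + (c + ∑ xs f) ≤⟨ +-mono-≤ (off (All.lookup y∉ x∈)) (∑-mono-at x∈ uniq at off) ⟩
  g y + (d + ∑ xs g) ≡⟨ exchange (g y) d (∑ xs g) ⟩
  d + (g y + ∑ xs g) ∎
  where
  open ≤-Reasoning
  exchange : ∀ a b c → a + (b + c) ≡ b + (a + c)
  exchange = solve-∀

∑⟦⟧≡0 : ∀ (p : A → Bool) {xs x} → ∑ xs (⟦_⟧ ∘ p) ≡ 0 → x ∈ xs → p x ≡ false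
∑⟦⟧≡0 p {x = x} ∑≡0 x∈ with p x in px
... | false = refl
... | true  = contradiction (subst₂ _≤_ (cong ⟦_⟧ px) ∑≡0 (∑-term (⟦_⟧ ∘ p) x∈)) λ ()

-- Vertices and edges of DCell

t-nonZero : ∀ k → NonZero (t k 2)
t-nonZero zero    = _
t-nonZero (suc k) = m*n≢0 (t k 2) (suc (t k 2)) {{t-nonZero k}}

uid<t : ∀ k n (u : V k n) → uid k n u < t k n
uid<t zero    n i       = toℕ<n i
uid<t (suc k) n (i , u) = begin-strict
  toℕ i * t k n + uid k n u <⟨ +-monoʳ-< (toℕ i * t k n) (uid<t k n u) ⟩
  toℕ i * t k n + t k n     ≡⟨ +-comm (toℕ i * t k n) _ ⟩
  suc (toℕ i) * t k n       ≤⟨ *-monoˡ-≤ (t k n) (toℕ<n i) ⟩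
  suc (t k n) * t k n       ≡⟨ *-comm (suc (t k n)) (t k n) ⟩
  t k n * suc (t k n)       ∎
  where open ≤-Reasoning

-- `uid` has leading digit `i` and a remainder below `t k n`, so reduction modulo `t k n` recovers
-- `u`, and cancellation then recovers `i`.
uid-injective : ∀ k n {u v : V k n} → uid k n u ≡ uid k n v → u ≡ v
uid-injective zero    n eq = toℕ-injective eq
uid-injective (suc k) n {i , u} {j , v} eq = cong₂ _,_ i≡j u≡v
  where
  instance
    _ : NonZero (t k n)
    _ = >-nonZero (≤-<-trans z≤n (uid<t k n u))
  remainder : ∀ (i : Fin (suc (t k n))) u → (toℕ i * t k n + uid k n u) % t k n ≡ uid k n u
  remainder i u = begin
    (toℕ i * t k n + uid k n u) % t k n ≡⟨ cong (_% t k n) (+-comm (toℕ i * t k n) _) ⟩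
    (uid k n u + toℕ i * t k n) % t k n ≡⟨ [m+kn]%n≡m%n (uid k n u) (toℕ i) (t k n) ⟩
    uid k n u % t k n                   ≡⟨ m<n⇒m%n≡m (uid<t k n u) ⟩
    uid k n u                           ∎
    where open ≡-Reasoning
  u≡v : u ≡ v
  u≡v = uid-injective k n (≡.trans (sym (remainder i u)) (≡.trans (cong (_% t k n) eq) (remainder j v)))
  i≡j : i ≡ j
  i≡j = toℕ-injective (*-cancelʳ-≡ _ _ (t k n) (+-cancelʳ-≡ (uid k n v) _ _
          (≡.trans (cong (λ w → toℕ i * t k n + uid k n w) (sym u≡v)) eq)))

-- Inverse of uid below t k 2; its value at larger arguments is irrelevant.
node : ∀ k → ℕ → V k 2
node zero    c = c mod 2
node (suc k) c = (c / t k 2) mod suc (t k 2) , node k (c % t k 2)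
  where instance _ = t-nonZero k

toℕ-mod : ∀ {c m} .{{_ : NonZero m}} → c < m → toℕ (c mod m) ≡ c
toℕ-mod {c} {m} c<m = ≡.trans (toℕ-fromℕ< (m%n<n c m)) (m<n⇒m%n≡m c<m)

uid-node : ∀ k {c} → c < t k 2 → uid k 2 (node k c) ≡ c
uid-node zero    c<t = toℕ-mod c<t
uid-node (suc k) {c} c<t = begin
  toℕ ((c / t k 2) mod suc (t k 2)) * t k 2 + uid k 2 (node k (c % t k 2))
    ≡⟨ cong₂ (λ a b → a * t k 2 + b) (toℕ-mod quotient<) (uid-node k (m%n<n c (t k 2))) ⟩
  c / t k 2 * t k 2 + c % t k 2
    ≡⟨ +-comm (c / t k 2 * t k 2) _ ⟩
  c % t k 2 + c / t k 2 * t k 2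
    ≡⟨ m≡m%n+[m/n]*n c (t k 2) ⟨
  c ∎
  where
  open ≡-Reasoning
  instance _ = t-nonZero k
  quotient< : c / t k 2 < suc (t k 2)
  quotient< = m<n*o⇒m/o<n (subst (c <_) (*-comm (t k 2) (suc (t k 2))) c<t)

allV-complete : ∀ k n (u : V k n) → u ∈ allV k n
allV-complete zero    n i       = ∈-allFin i
allV-complete (suc k) n (i , u) = ∈-cartesianProduct⁺ (∈-allFin i) (allV-complete k n u)

allV-unique : ∀ k n → Unique (allV k n)
allV-unique zero    n = Unique.allFin⁺ n
allV-unique (suc k) n = Unique.cartesianProduct⁺ (Unique.allFin⁺ _) (allV-unique k n)

length-allFin : ∀ n → length (allFin n) ≡ n
length-allFin n = length-tabulate {n = n} id

length-allV : ∀ k n → length (allV k n) ≡ t k n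
length-allV zero    n = length-allFin n
length-allV (suc k) n = begin
  length (allV (suc k) n)                                   ≡⟨ length-∑ (allV (suc k) n) ⟩
  ∑ (allV (suc k) n) (λ _ → 1)                              ≡⟨ ∑-× _ (allFin (suc (t k n))) (allV k n) ⟩
  ∑ (allFin (suc (t k n))) (λ _ → ∑ (allV k n) (λ _ → 1))   ≡⟨ ∑-const (allFin (suc (t k n))) _ ⟩
  length (allFin (suc (t k n))) * ∑ (allV k n) (λ _ → 1)    ≡⟨ cong₂ _*_ (length-allFin (suc (t k n))) (sym (length-∑ (allV k n))) ⟩
  suc (t k n) * length (allV k n)                           ≡⟨ cong (suc (t k n) *_) (length-allV k n) ⟩
  suc (t k n) * t k n                                       ≡⟨ *-comm (suc (t k n)) (t k n) ⟩
  t k n * suc (t k n)                                       ∎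
  where open ≡-Reasoning

adj-sym : ∀ k n (u v : V k n) → adj k n u v ≡ adj k n v u
adj-sym zero n i j with i ≟ᶠ j | j ≟ᶠ i
... | yes _    | yes _    = refl
... | no _     | no _     = refl
... | yes refl | no j≢i   = contradiction refl j≢i
... | no i≢j   | yes refl = contradiction refl i≢j
adj-sym (suc k) n (i , u) (j , v) with i ≟ᶠ j | j ≟ᶠ i
... | yes _    | yes _    = adj-sym k n u v
... | no _     | no _     = ∨-comm _ ((toℕ j <ᵇ toℕ i) ∧ _)
... | yes refl | no j≢i   = contradiction refl j≢i
... | no i≢j   | yes refl = contradiction refl i≢j

adj-same : ∀ k n i (u v : V k n) → adj (suc k) n (i , u) (i , v) ≡ adj k n u v
adj-same k n i u v with i ≟ᶠ i
... | yes _  = refl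
... | no i≢i = contradiction refl i≢i

<⇒<ᵇ≡true : ∀ {m n} → m < n → (m <ᵇ n) ≡ true
<⇒<ᵇ≡true m<n = Equivalence.to T-≡ (<⇒<ᵇ m<n)

≤⇒<ᵇ≡false : ∀ {m n} → n ≤ m → (m <ᵇ n) ≡ false
≤⇒<ᵇ≡false {m} {n} n≤m with m <ᵇ n in eq
... | false = refl
... | true  = contradiction (<ᵇ⇒< m n (Equivalence.from T-≡ eq)) (≤⇒≯ n≤m)

<ᵇ≡true⇒< : ∀ {m n} → (m <ᵇ n) ≡ true → m < n
<ᵇ≡true⇒< {m} {n} eq = <ᵇ⇒< m n (Equivalence.from T-≡ eq)

≡ᵇ≡true⇒≡ : ∀ {m n} → (m ≡ᵇ n) ≡ true → m ≡ n
≡ᵇ≡true⇒≡ {m} {n} eq = ≡ᵇ⇒≡ m n (Equivalence.from T-≡ eq)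

≡⇒≡ᵇ≡true : ∀ {m n} → m ≡ n → (m ≡ᵇ n) ≡ true
≡⇒≡ᵇ≡true {m} {n} eq = Equivalence.to T-≡ (≡⇒≡ᵇ m n eq)

-- The uid of the vertex in copy i whose edge leads to copy j.
link : ∀ {m} → Fin m → Fin m → ℕ
link i j = if toℕ i <ᵇ toℕ j then toℕ j ∸ 1 else toℕ j

-- Once copy `i` is skipped, the other copies in increasing order are joined to its vertices in the
-- order of uids. Hence every vertex has exactly one edge leaving its copy.
link-punchIn : ∀ {m} (i : Fin (suc m)) (c : Fin m) → link i (punchIn i c) ≡ toℕ c
link-punchIn zero    c       = refl
link-punchIn (suc i) zero    = refl
link-punchIn (suc i) (suc c) with toℕ i <ᵇ toℕ (punchIn i c) in i<j | link-punchIn i c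
... | false | eq = cong suc eq
... | true  | eq = ≡.trans (sym (suc-pred _ {{>-nonZero (≤-<-trans z≤n (<ᵇ≡true⇒< i<j))}})) (cong suc eq)

private
  link-< : ∀ {m} {i j : Fin m} → toℕ i < toℕ j → link i j ≡ toℕ j ∸ 1
  link-< i<j rewrite <⇒<ᵇ≡true i<j = refl

  link-> : ∀ {m} {i j : Fin m} → toℕ j < toℕ i → link i j ≡ toℕ j
  link-> j<i rewrite ≤⇒<ᵇ≡false (<⇒≤ j<i) = refl

-- The two orders of `i` and `j` match the two disjuncts of `adj`. Copy indices run up to `t k 2`,
-- so both link values stay below `t k 2` and `uid-node` applies.
adj-link : ∀ k {i j} → i ≢ j → adj (suc k) 2 (i , node k (link i j)) (j , node k (link j i)) ≡ true
adj-link k {i} {j} i≢j with i ≟ᶠ j | <-cmp (toℕ i) (toℕ j)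
... | yes i≡j | _             = contradiction i≡j i≢j
... | no _    | tri≈ _ i≡j _  = contradiction (toℕ-injective i≡j) i≢j
... | no _    | tri< i<j _ _
  rewrite link-< i<j | link-> i<j | <⇒<ᵇ≡true i<j
  | uid-node k {toℕ j ∸ 1} (≤-trans (≤-reflexive (suc-pred (toℕ j) {{>-nonZero (≤-<-trans z≤n i<j)}})) (s≤s⁻¹ (toℕ<n j)))
  | uid-node k {toℕ i} (<-≤-trans i<j (s≤s⁻¹ (toℕ<n j)))
  | ≡⇒≡ᵇ≡true {toℕ j ∸ 1} refl | ≡⇒≡ᵇ≡true {toℕ i} refl = refl
... | no _    | tri> _ _ j<i
  rewrite link-< j<i | link-> j<i | <⇒<ᵇ≡true j<i
  | uid-node k {toℕ i ∸ 1} (≤-trans (≤-reflexive (suc-pred (toℕ i) {{>-nonZero (≤-<-trans z≤n j<i)}})) (s≤s⁻¹ (toℕ<n i)))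
  | uid-node k {toℕ j} (<-≤-trans j<i (s≤s⁻¹ (toℕ<n i)))
  | ≡⇒≡ᵇ≡true {toℕ i ∸ 1} refl | ≡⇒≡ᵇ≡true {toℕ j} refl = ∨-zeroʳ _

-- Edge boundaries

∁ : (A → Bool) → A → Bool
∁ X = not ∘ X

size : ∀ k → (V k 2 → Bool) → ℕ
size k X = ∑ (allV k 2) (⟦_⟧ ∘ X)

-- |∂X|, every boundary edge being counted from its end in X.
boundary : ∀ k → (V k 2 → Bool) → ℕ
boundary k X = ∑ (allV k 2) λ u → ∑ (allV k 2) λ v → ⟦ adj k 2 u v ∧ X u ∧ not (X v) ⟧

slice : ∀ {k n} → (V (suc k) n → Bool) → Fin (suc (t k n)) → V k n → Bool
slice X i u = X (i , u)

size-∁ : ∀ k X → size k X + size k (∁ X) ≡ t k 2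
size-∁ k X = begin
  size k X + size k (∁ X)                     ≡⟨ ∑-distrib-+ _ _ (allV k 2) ⟨
  ∑ (allV k 2) (λ u → ⟦ X u ⟧ + ⟦ not (X u) ⟧) ≡⟨ ∑-cong (allV k 2) (λ u → b+¬b (X u)) ⟩
  ∑ (allV k 2) (λ _ → 1)                      ≡⟨ length-∑ (allV k 2) ⟨
  length (allV k 2)                           ≡⟨ length-allV k 2 ⟩
  t k 2                                       ∎
  where
  open ≡-Reasoning
  b+¬b : ∀ b → ⟦ b ⟧ + ⟦ not b ⟧ ≡ 1
  b+¬b true  = refl
  b+¬b false = refl

size-∁∁ : ∀ k X → size k (∁ (∁ X)) ≡ size k X
size-∁∁ k X = ∑-cong (allV k 2) (λ u → cong ⟦_⟧ (not-involutive (X u)))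

size-slices : ∀ k X → size (suc k) X ≡ ∑ (allFin (suc (t k 2))) (λ i → size k (slice X i))
size-slices k X = ∑-× (⟦_⟧ ∘ X) (allFin (suc (t k 2))) (allV k 2)

size≡0⇒∉ : ∀ k X → size k X ≡ 0 → ∀ u → X u ≡ false
size≡0⇒∉ k X |X|≡0 u = ∑⟦⟧≡0 X |X|≡0 (allV-complete k 2 u)

-- Exchanging the two summations reads every edge from its other end, and adjacency is symmetric.
boundary-∁ : ∀ k X → boundary k (∁ X) ≡ boundary k X
boundary-∁ k X = ≡.trans (∑-swap _ (allV k 2) (allV k 2)) (∑-cong (allV k 2) λ u → ∑-cong (allV k 2) (cong ⟦_⟧ ∘ flip-edge u))
  where
  flip-edge : ∀ u v → adj k 2 v u ∧ not (X v) ∧ not (not (X u)) ≡ adj k 2 u v ∧ X u ∧ not (X v)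
  flip-edge u v rewrite adj-sym k 2 v u | not-involutive (X u) | ∧-comm (not (X v)) (X u) = refl

-- Splitting a boundary along the copies

module Crossing {k} (X : V (suc k) 2 → Bool) where

  copies : List (Fin (suc (t k 2)))
  copies = allFin (suc (t k 2))

  -- Does the end in copy i of the edge between copies i and j belong to X?
  end : Fin (suc (t k 2)) → Fin (suc (t k 2)) → Bool
  end i j = not ⌊ i ≟ᶠ j ⌋ ∧ X (i , node k (link i j))

  -- Oriented from copy `i` to copy `j`, so that an edge of ∂X between two copies is counted in
  -- exactly one row.
  cross : Fin (suc (t k 2)) → Fin (suc (t k 2)) → Bool
  cross i j = end i j ∧ not (end j i)

  row : Fin (suc (t k 2)) → ℕ
  row i = ∑ copies (⟦_⟧ ∘ cross i)

  end-≡ : ∀ {i j} → i ≡ j → end i j ≡ false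
  end-≡ {i} {j} i≡j with i ≟ᶠ j
  ... | yes _  = refl
  ... | no i≢j = contradiction i≡j i≢j

  end-≢ : ∀ {i j} → i ≢ j → end i j ≡ X (i , node k (link i j))
  end-≢ {i} {j} i≢j with i ≟ᶠ j
  ... | yes i≡j = contradiction i≡j i≢j
  ... | no _    = refl

  end-empty : ∀ {i} → size k (slice X i) ≡ 0 → ∀ j → end i j ≡ false
  end-empty {i} |Xᵢ|≡0 j with i ≟ᶠ j
  ... | yes _ = refl
  ... | no _  = size≡0⇒∉ k (slice X i) |Xᵢ|≡0 _

  end-full : ∀ {i} → size k (∁ (slice X i)) ≡ 0 → ∀ {j} → i ≢ j → end i j ≡ true
  end-full {i} |∁Xᵢ|≡0 i≢j = ≡.trans (end-≢ i≢j) (not-injective (size≡0⇒∉ k (∁ (slice X i)) |∁Xᵢ|≡0 _))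

  -- The double sum is cut into blocks by the copies of the two ends. A diagonal block is the inner
  -- boundary of a slice, and an off-diagonal block contains the term of the edge linking the two
  -- copies.
  boundary-slices : ∑ copies (λ i → boundary k (slice X i) + row i) ≤ boundary (suc k) X
  boundary-slices = begin
    ∑ copies (λ i → boundary k (slice X i) + row i)
      ≤⟨ ∑-mono copies copy ⟩
    ∑ copies (λ i → ∑ (allV k 2) λ u → ∑ copies λ j → ∑ (allV k 2) (edge i u j))
      ≡⟨ ∑-cong copies (λ i → ∑-cong (allV k 2) (λ u → ∑-× _ copies (allV k 2))) ⟨
    ∑ copies (λ i → ∑ (allV k 2) λ u → ∑ (allV (suc k) 2) λ w → edge i u (proj₁ w) (proj₂ w))
      ≡⟨ ∑-× _ copies (allV k 2) ⟨
    boundary (suc k) X ∎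
    where
    open ≤-Reasoning
    edge : Fin (suc (t k 2)) → V k 2 → Fin (suc (t k 2)) → V k 2 → ℕ
    edge i u j v = ⟦ adj (suc k) 2 (i , u) (j , v) ∧ X (i , u) ∧ not (X (j , v)) ⟧
    between : Fin (suc (t k 2)) → Fin (suc (t k 2)) → ℕ
    between i j = ∑ (allV k 2) λ u → ∑ (allV k 2) (edge i u j)
    within : ∀ i → boundary k (slice X i) ≡ between i i
    within i = ∑-cong (allV k 2) λ u → ∑-cong (allV k 2) λ v →
      cong (λ b → ⟦ b ∧ X (i , u) ∧ not (X (i , v)) ⟧) (sym (adj-same k 2 i u v))
    linked : ∀ i {j} → j ≢ i → ⟦ cross i j ⟧ ≤ between i j
    linked i {j} j≢i = begin
      ⟦ cross i j ⟧
        ≡⟨ cong₂ (λ a b → ⟦ a ∧ not b ⟧) (end-≢ (j≢i ∘ sym)) (end-≢ j≢i) ⟩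
      ⟦ X (i , node k (link i j)) ∧ not (X (j , node k (link j i))) ⟧
        ≡⟨ cong (λ a → ⟦ a ∧ X (i , node k (link i j)) ∧ not (X (j , node k (link j i))) ⟧) (adj-link k (j≢i ∘ sym)) ⟨
      edge i (node k (link i j)) j (node k (link j i))
        ≤⟨ ∑-term _ (allV-complete k 2 _) ⟩
      ∑ (allV k 2) (edge i (node k (link i j)) j)
        ≤⟨ ∑-term (λ u → ∑ (allV k 2) (edge i u j)) (allV-complete k 2 (node k (link i j))) ⟩
      between i j ∎
    copy : ∀ i → boundary k (slice X i) + row i ≤ ∑ (allV k 2) λ u → ∑ copies λ j → ∑ (allV k 2) (edge i u j)
    copy i = begin
      boundary k (slice X i) + row i
        -- The row has term zero on the diagonal, which leaves that index free to absorb the inner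
        -- boundary.
        ≤⟨ ∑-mono-at {d = 0} (∈-allFin i) (Unique.allFin⁺ _) at-i (linked i) ⟩
      ∑ copies (between i)
        ≡⟨ ∑-swap (λ u j → ∑ (allV k 2) (edge i u j)) (allV k 2) copies ⟨
      ∑ (allV k 2) (λ u → ∑ copies λ j → ∑ (allV k 2) (edge i u j)) ∎
      where
      at-i : boundary k (slice X i) + ⟦ cross i i ⟧ ≤ between i i
      at-i rewrite end-≡ {i} refl = ≤-reflexive (≡.trans (+-identityʳ _) (within i))

  -- Each vertex of copy `i` owns one edge to another copy. `target` names that copy, with
  -- `punchIn i` skipping `i` itself, and different vertices have different targets.
  size-slice≤ : ∀ i → size k (slice X i) ≤ ∑ copies (⟦_⟧ ∘ end i)
  size-slice≤ i = ∑-reindex target target-injective (allV-unique k 2) ∈-allFin (≤-reflexive ∘ cong ⟦_⟧ ∘ at-target)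
    where
    target : V k 2 → Fin (suc (t k 2))
    target u = punchIn i (fromℕ< (uid<t k 2 u))
    target-injective : ∀ {u v} → target u ≡ target v → u ≡ v
    target-injective {u} {v} eq =
      uid-injective k 2 (fromℕ<-injective _ _ (uid<t k 2 u) (uid<t k 2 v) (punchIn-injective i _ _ eq))
    node-link : ∀ u → node k (link i (target u)) ≡ u
    node-link u = uid-injective k 2 (begin
      uid k 2 (node k (link i (target u))) ≡⟨ cong (uid k 2 ∘ node k) link≡uid ⟩
      uid k 2 (node k (uid k 2 u))         ≡⟨ uid-node k (uid<t k 2 u) ⟩
      uid k 2 u                            ∎)
      where
      open ≡-Reasoning
      link≡uid : link i (target u) ≡ uid k 2 u
      link≡uid = ≡.trans (link-punchIn i _) (toℕ-fromℕ< (uid<t k 2 u))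
    at-target : ∀ u → X (i , u) ≡ end i (target u)
    at-target u = sym (≡.trans (end-≢ (punchInᵢ≢i i _ ∘ sym)) (cong (λ v → X (i , v)) (node-link u)))

  cross-row-empty : ∀ i {j} → end j i ≡ false → ⟦ end i j ⟧ ≤ ⟦ cross i j ⟧
  cross-row-empty i {j} eq rewrite eq = ≤-reflexive (cong ⟦_⟧ (sym (∧-identityʳ (end i j))))

  size≤row : ∀ i → (∀ {j} → j ≢ i → size k (slice X j) ≡ 0) → size k (slice X i) ≤ row i
  size≤row i others = ≤-trans (size-slice≤ i) (∑-mono copies term)
    where
    term : ∀ j → ⟦ end i j ⟧ ≤ ⟦ cross i j ⟧
    term j = cross-row-empty i (absent (j ≟ᶠ i))
      where
      absent : Dec (j ≡ i) → end j i ≡ false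
      absent (yes j≡i) = end-≡ j≡i
      absent (no j≢i)  = end-empty (others j≢i) i

  -- Only the edge between `i` and `j` may have both ends in X, and the extra 1 pays for it.
  size≤1+row : ∀ i j → (∀ {l} → l ≢ i → l ≢ j → size k (slice X l) ≡ 0) → size k (slice X i) ≤ 1 + row i
  size≤1+row i j others = ≤-trans (size-slice≤ i)
    (∑-mono-at {c = 0} {d = 1} (∈-allFin j) (Unique.allFin⁺ _) (≤-trans (⟦⟧≤1 (end i j)) (m≤m+n 1 _)) term)
    where
    term : ∀ {l} → l ≢ j → ⟦ end i l ⟧ ≤ ⟦ cross i l ⟧
    term {l} l≢j = cross-row-empty i (absent (l ≟ᶠ i))
      where
      absent : Dec (l ≡ i) → end l i ≡ false
      absent (yes l≡i) = end-≡ l≡i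
      absent (no l≢i)  = end-empty (others l≢i l≢j) i

-- Isoperimetry

-- h k s bounds below the boundary in D_{k+1,2} of a set of s vertices, s being at
-- most half of all; h k 3 = 3 (k + 2) ∸ 4 is the boundary of a path on 3 vertices.
h : ℕ → ℕ → ℕ
h k 0 = 0
h k 1 = 2 + k
h k 2 = 2 + 2 * k
h k 3 = 2 + 3 * k
h k (suc (suc (suc (suc _)))) = 3 + 3 * k

h-step : ∀ k s → h k s ≤ h k (suc s)
h-step k 0 = z≤n
h-step k 1 = s≤s (s≤s (m≤m+n k _))
h-step k 2 = s≤s (s≤s (m≤n+m (2 * k) k))
h-step k 3 = n≤1+n _
h-step k (suc (suc (suc (suc _)))) = ≤-refl

h-mono : ∀ k {r s} → r ≤ s → h k r ≤ h k s
h-mono k = go ∘ ≤⇒≤′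
  where
  go : ∀ {r s} → r ≤′ s → h k r ≤ h k s
  go ≤′-refl                = ≤-refl
  go (≤′-step {n = s} r≤′s) = ≤-trans (go r≤′s) (h-step k s)

-- `h k (4 + s)` reduces to the plateau `3 + 3 * k`, so monotonicity along `s ≤ 4 + s` is enough.
h-max : ∀ k s → h k s ≤ 3 + 3 * k
h-max k s = h-mono k (m≤n+m s 4)

private
  slack : ∀ {a b c} r → a ≤ b → a + r ≡ c → c ≤ b + r
  slack r a≤b refl = +-monoˡ-≤ r a≤b

  from-sum : ∀ {a b} r → a + r ≡ b → a ≤ b
  from-sum r refl = m≤m+n _ r

-- The surplus 2 pays for the edge joining two copies that X meets, which may be lost once on each
-- side. The bound is tight for 1 + 1 and 1 + 2; in all other cases the plateau caps the left side.
h-split : ∀ k {a b} → 1 ≤ a → 1 ≤ b → 2 + h (suc k) (a + b) ≤ h (suc k) a + h (suc k) b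
h-split k {1} {1} _ _ = ≤-reflexive (eq k)
  where
  eq : ∀ k → 2 + (2 + 2 * (1 + k)) ≡ 2 + (1 + k) + (2 + (1 + k))
  eq = solve-∀
h-split k {1} {2} _ _ = ≤-reflexive (eq k)
  where
  eq : ∀ k → 2 + (2 + 3 * (1 + k)) ≡ 2 + (1 + k) + (2 + 2 * (1 + k))
  eq = solve-∀
h-split k {2} {1} _ _ = ≤-reflexive (eq k)
  where
  eq : ∀ k → 2 + (2 + 3 * (1 + k)) ≡ 2 + 2 * (1 + k) + (2 + (1 + k))
  eq = solve-∀
h-split k {1} {b@(suc (suc (suc _)))} _ _ =
  ≤-trans (from-sum k (eq k)) (+-monoʳ-≤ (2 + suc k) (h-mono (suc k) {3} {b} (s≤s (s≤s (s≤s z≤n)))))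
  where
  eq : ∀ k → 2 + (3 + 3 * (1 + k)) + k ≡ 2 + (1 + k) + (2 + 3 * (1 + k))
  eq = solve-∀
h-split k {a@(suc (suc (suc _)))} {1} _ _ =
  ≤-trans (s≤s (s≤s (h-max (suc k) (a + 1)))) (≤-trans (from-sum k (eq k))
    (+-monoˡ-≤ (2 + suc k) (h-mono (suc k) {3} {a} (s≤s (s≤s (s≤s z≤n))))))
  where
  eq : ∀ k → 2 + (3 + 3 * (1 + k)) + k ≡ 2 + 3 * (1 + k) + (2 + (1 + k))
  eq = solve-∀
h-split k {a@(suc (suc _))} {b@(suc (suc _))} _ _ =
  ≤-trans (s≤s (s≤s (h-max (suc k) (a + b)))) (≤-trans (from-sum k (eq k))
    (+-mono-≤ (h-mono (suc k) {2} {a} (s≤s (s≤s z≤n))) (h-mono (suc k) {2} {b} (s≤s (s≤s z≤n)))))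
  where
  eq : ∀ k → 2 + (3 + 3 * (1 + k)) + k ≡ 2 + 2 * (1 + k) + (2 + 2 * (1 + k))
  eq = solve-∀

-- `6 + 3 * k` is the plateau of `h (suc k)`. Equality holds at `k = 0`, and from then on `t` at
-- least doubles while the left side grows by 3.
6+3k≤t : ∀ k → 6 + 3 * k ≤ t (suc k) 2
6+3k≤t zero    = ≤-refl
6+3k≤t (suc k) = begin
  6 + 3 * suc k                ≡⟨ eq k ⟩
  (6 + 3 * k) + 3              ≤⟨ +-mono-≤ (6+3k≤t k) (m≤m+n 3 _) ⟩
  m + (6 + 3 * k)              ≤⟨ +-monoʳ-≤ m (6+3k≤t k) ⟩
  m + m                        ≤⟨ +-monoʳ-≤ m (m≤m*n m m {{t-nonZero (suc k)}}) ⟩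
  m + m * m                    ≡⟨ *-suc m m ⟨
  m * suc m                    ∎
  where
  open ≤-Reasoning
  m : ℕ
  m = t (suc k) 2
  eq : ∀ k → 6 + 3 * (1 + k) ≡ 6 + 3 * k + 3
  eq = solve-∀

-- A proper part of one copy loses its inner boundary and one edge per vertex.
h-copy : ∀ k x c {e} → h k (x ⊓ c) ≤ e → 1 ≤ x → 1 ≤ c → 6 + 3 * k ≤ x + c → h (suc k) x ≤ e + x
h-copy k 1 (suc _) h≤e _ _ _ = slack 1 h≤e (eq k)
  where
  eq : ∀ k → 2 + k + 1 ≡ 2 + (1 + k)
  eq = solve-∀
h-copy k 2 1 _ _ _ (s≤s (s≤s (s≤s ())))
h-copy k 2 (suc (suc c)) h≤e _ _ _ = slack 2 h≤e (eq k)
  where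
  eq : ∀ k → 2 + 2 * k + 2 ≡ 2 + 2 * (1 + k)
  eq = solve-∀
h-copy k 3 1 _ _ _ (s≤s (s≤s (s≤s (s≤s ()))))
h-copy k 3 2 _ _ _ (s≤s (s≤s (s≤s (s≤s (s≤s ())))))
h-copy k 3 (suc (suc (suc c))) h≤e _ _ _ = slack 3 h≤e (eq k)
  where
  eq : ∀ k → 2 + 3 * k + 3 ≡ 2 + 3 * (1 + k)
  eq = solve-∀
-- A small `c` makes the inner bound small, but `large` then forces `x` to be at least `6 + 3 * k`
-- minus `c`, which compensates.
h-copy k x@(suc (suc (suc (suc _)))) 1 {e} h≤e _ _ large = begin
  3 + 3 * suc k           ≤⟨ from-sum (1 + k) (eq k) ⟩
  2 + k + (5 + 3 * k)     ≤⟨ +-mono-≤ h≤e (+-cancelʳ-≤ 1 _ _ (≤-trans (≤-reflexive (+-comm (5 + 3 * k) 1)) large)) ⟩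
  e + x                   ∎
  where
  open ≤-Reasoning
  eq : ∀ k → 3 + 3 * (1 + k) + (1 + k) ≡ 2 + k + (5 + 3 * k)
  eq = solve-∀
h-copy k x@(suc (suc (suc (suc _)))) 2 {e} h≤e _ _ large = begin
  3 + 3 * suc k               ≤⟨ from-sum (2 * k) (eq k) ⟩
  2 + 2 * k + (4 + 3 * k)     ≤⟨ +-mono-≤ h≤e (+-cancelʳ-≤ 2 _ _ (≤-trans (≤-reflexive (+-comm (4 + 3 * k) 2)) large)) ⟩
  e + x                       ∎
  where
  open ≤-Reasoning
  eq : ∀ k → 3 + 3 * (1 + k) + 2 * k ≡ 2 + 2 * k + (4 + 3 * k)
  eq = solve-∀
-- Both parts have at least three vertices: `h k 3` together with four of the vertices in `x`
-- already reaches the plateau.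
h-copy k x@(suc (suc (suc (suc m)))) (suc (suc (suc c))) {e} h≤e _ _ large = begin
  3 + 3 * suc k       ≡⟨ eq k ⟩
  2 + 3 * k + 4       ≤⟨ +-mono-≤ (≤-trans (h-mono k {3} {x ⊓ suc (suc (suc c))} (s≤s (s≤s (s≤s z≤n)))) h≤e) (m≤m+n 4 m) ⟩
  e + x               ∎
  where
  open ≤-Reasoning
  eq : ∀ k → 3 + 3 * (1 + k) ≡ 2 + 3 * k + 4
  eq = solve-∀

Isoperimetric : ℕ → Set
Isoperimetric k = ∀ X → h k (size (suc k) X ⊓ size (suc k) (∁ X)) ≤ boundary (suc k) X

all-zero-or-positive : ∀ (f : A → ℕ) xs → (∀ {x} → x ∈ xs → f x ≡ 0) ⊎ ∃ λ x → x ∈ xs × 1 ≤ f x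
all-zero-or-positive f []       = inj₁ λ ()
all-zero-or-positive f (x ∷ xs) with f x in fx | all-zero-or-positive f xs
... | suc _ | _                   = inj₂ (x , here refl , subst (1 ≤_) (sym fx) (s≤s z≤n))
... | zero  | inj₂ (y , y∈ , 1≤y) = inj₂ (y , there y∈ , 1≤y)
... | zero  | inj₁ zeros          = inj₁ λ { (here refl) → fx ; (there y∈) → zeros y∈ }

-- The inductive step: how a vertex set meets the copies

module Step {k} (iso : Isoperimetric k) (X : V (2 + k) 2 → Bool) where
  open Crossing X
  open ≤-Reasoning

  inside outside edges : Fin (suc (t (suc k) 2)) → ℕ
  inside  i = size (suc k) (slice X i)
  outside i = size (suc k) (∁ (slice X i))
  edges   i = boundary (suc k) (slice X i)

  edges≥ : ∀ i → 1 ≤ inside i → 1 ≤ outside i → 2 + k ≤ edges i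
  edges≥ i 1≤in 1≤out = ≤-trans (h-mono k {1} (⊓-glb 1≤in 1≤out)) (iso (slice X i))

  edges+inside≥ : ∀ i → 1 ≤ inside i → 1 ≤ outside i → h (suc k) (inside i) ≤ edges i + inside i
  edges+inside≥ i 1≤in 1≤out = h-copy k (inside i) (outside i) (iso (slice X i)) 1≤in 1≤out
    (≤-trans (6+3k≤t k) (≤-reflexive (sym (size-∁ (suc k) (slice X i)))))

  -- Every third copy either is split or sends an edge of ∂X to copy i or to copy j.
  full-and-empty : ∀ {i j} → outside i ≡ 0 → inside j ≡ 0 → t (suc k) 2 ≤ boundary (2 + k) X
  full-and-empty {i} {j} full empty with ys , copies↭ ← extract (∈-allFin i) = begin
    t (suc k) 2
      ≡⟨ suc-injective (≡.trans (sym (length-allFin _)) (≡.trans (length-∑ copies) (≡.trans (∑-↭ (λ _ → 1) copies↭) (cong suc (sym (length-∑ ys)))))) ⟩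
    length ys
      ≡⟨ length-∑ ys ⟩
    ∑ ys (λ _ → 1)
      ≤⟨ ∑-mono ys each ⟩
    ∑ ys (λ l → ⟦ cross i l ⟧ + (edges l + ⟦ cross l j ⟧))
      ≡⟨ ∑-distrib-+ _ _ ys ⟩
    ∑ ys (⟦_⟧ ∘ cross i) + ∑ ys (λ l → edges l + ⟦ cross l j ⟧)
      -- An edge out of copy `i` is charged to row `i`, and an edge into copy `j` to the row of its
      -- source `l` in `ys`. As `ys` omits `i`, no edge is charged twice.
      ≤⟨ +-mono-≤ row-i (∑-mono ys (λ l → +-monoʳ-≤ (edges l) (∑-term (⟦_⟧ ∘ cross l) (∈-allFin j)))) ⟩
    (edges i + row i) + ∑ ys (λ l → edges l + row l)
      ≡⟨ ∑-↭ _ copies↭ ⟨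
    ∑ copies (λ l → edges l + row l)
      ≤⟨ boundary-slices ⟩
    boundary (2 + k) X ∎
    where
    row-i : ∑ ys (⟦_⟧ ∘ cross i) ≤ edges i + row i
    row-i = ≤-trans (m≤n+m _ ⟦ cross i i ⟧) (≤-trans (≤-reflexive (sym (∑-↭ (⟦_⟧ ∘ cross i) copies↭))) (m≤n+m _ (edges i)))
    distinct : ∀ {a b} → outside a ≡ 0 → inside b ≡ 0 → a ≢ b
    distinct {a} |∁Xₐ|≡0 |Xₐ|≡0 refl = contradiction
      (≡.trans (sym (size-∁ (suc k) (slice X a))) (cong₂ _+_ |Xₐ|≡0 |∁Xₐ|≡0))
      (λ t≡0 → contradiction (subst (6 + 3 * k ≤_) t≡0 (6+3k≤t k)) λ ())
    crosses : ∀ {a b} → outside a ≡ 0 → inside b ≡ 0 → cross a b ≡ true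
    crosses {a} {b} |∁Xₐ|≡0 |X_b|≡0 rewrite end-full {a} |∁Xₐ|≡0 {b} (distinct |∁Xₐ|≡0 |X_b|≡0) | end-empty {b} |X_b|≡0 a = refl
    each : ∀ l → 1 ≤ ⟦ cross i l ⟧ + (edges l + ⟦ cross l j ⟧)
    each l with inside l ≟ 0 | outside l ≟ 0
    ... | yes in≡0 | _         = ≤-trans (≤-reflexive (cong ⟦_⟧ (sym (crosses full in≡0)))) (m≤m+n _ _)
    ... | no _     | yes out≡0 = ≤-trans (≤-reflexive (cong ⟦_⟧ (sym (crosses out≡0 empty)))) (≤-trans (m≤n+m _ (edges l)) (m≤n+m _ ⟦ cross i l ⟧))
    ... | no in≢0  | no out≢0  = ≤-trans (≤-trans (s≤s z≤n) (edges≥ l (n≢0⇒n>0 in≢0) (n≢0⇒n>0 out≢0))) (≤-trans (m≤m+n (edges l) _) (m≤n+m _ ⟦ cross i l ⟧))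

  -- Cases by the number of copies that X meets: none, one, two, or at least three. As no copy is
  -- full, each copy met is split, so the induction hypothesis bounds its inner boundary from below.
  no-full : (∀ i → 1 ≤ outside i) → h (suc k) (size (2 + k) X) ≤ boundary (2 + k) X
  no-full 1≤out with all-zero-or-positive inside copies
  ... | inj₁ none = ≤-trans (≤-reflexive (cong (h (suc k)) |X|≡0)) z≤n
    where
    |X|≡0 : size (2 + k) X ≡ 0
    |X|≡0 = n≤0⇒n≡0 (begin
      size (2 + k) X      ≡⟨ size-slices (suc k) X ⟩
      ∑ copies inside     ≤⟨ ∑-mono-∈ copies (≤-reflexive ∘ none) ⟩
      ∑ copies (λ _ → 0)  ≡⟨ ∑-0 copies ⟩
      0                   ∎)
  ... | inj₂ (i , i∈ , 1≤i) with ys , copies↭ ← extract i∈ with all-zero-or-positive inside ys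
  ...   | inj₁ rest = begin
    h (suc k) (size (2 + k) X)       ≤⟨ h-mono (suc k) |X|≤ ⟩
    h (suc k) (inside i)             ≤⟨ edges+inside≥ i 1≤i (1≤out i) ⟩
    edges i + inside i               ≤⟨ +-monoʳ-≤ (edges i) (size≤row i others) ⟩
    edges i + row i                  ≤⟨ ∑-term (λ l → edges l + row l) i∈ ⟩
    ∑ copies (λ l → edges l + row l) ≤⟨ boundary-slices ⟩
    boundary (2 + k) X               ∎
    where
    others : ∀ {l} → l ≢ i → inside l ≡ 0
    others {l} l≢i with ∈-resp-↭ copies↭ (∈-allFin l)
    ... | here l≡i = contradiction l≡i l≢i
    ... | there l∈ = rest l∈
    |X|≤ : size (2 + k) X ≤ inside i
    |X|≤ = begin
      size (2 + k) X               ≡⟨ size-slices (suc k) X ⟩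
      ∑ copies inside              ≡⟨ ∑-↭ inside copies↭ ⟩
      inside i + ∑ ys inside       ≤⟨ +-monoʳ-≤ (inside i) (∑-mono-∈ ys (≤-reflexive ∘ rest)) ⟩
      inside i + ∑ ys (λ _ → 0)    ≡⟨ cong (inside i +_) (∑-0 ys) ⟩
      inside i + 0                 ≡⟨ +-identityʳ _ ⟩
      inside i                     ∎
  ...   | inj₂ (j , j∈ , 1≤j) with zs , ys↭ ← extract j∈ with all-zero-or-positive inside zs
  -- Each of the two row bounds gives up 1 for the edge joining `i` and `j`; the surplus of
  -- `h-split` restores both units.
  ...     | inj₁ rest = +-cancelˡ-≤ 2 _ _ (begin
    2 + h (suc k) (size (2 + k) X)                      ≤⟨ +-monoʳ-≤ 2 (h-mono (suc k) |X|≤) ⟩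
    2 + h (suc k) (inside i + inside j)                 ≤⟨ h-split k 1≤i 1≤j ⟩
    h (suc k) (inside i) + h (suc k) (inside j)         ≤⟨ +-mono-≤ (edges+inside≥ i 1≤i (1≤out i)) (edges+inside≥ j 1≤j (1≤out j)) ⟩
    (edges i + inside i) + (edges j + inside j)         ≤⟨ +-mono-≤ (+-monoʳ-≤ (edges i) (size≤1+row i j others)) (+-monoʳ-≤ (edges j) (size≤1+row j i (λ l≢j l≢i → others l≢i l≢j))) ⟩
    (edges i + (1 + row i)) + (edges j + (1 + row j))   ≡⟨ collect (edges i) (row i) (edges j) (row j) ⟩
    2 + ((edges i + row i) + (edges j + row j))         ≤⟨ +-monoʳ-≤ 2 (+-monoʳ-≤ (edges i + row i) (∑-term (λ l → edges l + row l) j∈)) ⟩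
    2 + ((edges i + row i) + ∑ ys (λ l → edges l + row l)) ≡⟨ cong (2 +_) (∑-↭ _ copies↭) ⟨
    2 + ∑ copies (λ l → edges l + row l)                ≤⟨ +-monoʳ-≤ 2 boundary-slices ⟩
    2 + boundary (2 + k) X                              ∎)
    where
    collect : ∀ a b c d → (a + (1 + b)) + (c + (1 + d)) ≡ 2 + ((a + b) + (c + d))
    collect = solve-∀
    others : ∀ {l} → l ≢ i → l ≢ j → inside l ≡ 0
    others {l} l≢i l≢j with ∈-resp-↭ copies↭ (∈-allFin l)
    ... | here l≡i = contradiction l≡i l≢i
    ... | there l∈ with ∈-resp-↭ ys↭ l∈
    ...   | here l≡j  = contradiction l≡j l≢j
    ...   | there l∈′ = rest l∈′
    |X|≤ : size (2 + k) X ≤ inside i + inside j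
    |X|≤ = begin
      size (2 + k) X                            ≡⟨ size-slices (suc k) X ⟩
      ∑ copies inside                           ≡⟨ ∑-↭ inside copies↭ ⟩
      inside i + ∑ ys inside                    ≡⟨ cong (inside i +_) (∑-↭ inside ys↭) ⟩
      inside i + (inside j + ∑ zs inside)       ≤⟨ +-monoʳ-≤ (inside i) (+-monoʳ-≤ (inside j) (∑-mono-∈ zs (≤-reflexive ∘ rest))) ⟩
      inside i + (inside j + ∑ zs (λ _ → 0))    ≡⟨ cong (λ s → inside i + (inside j + s)) (∑-0 zs) ⟩
      inside i + (inside j + 0)                 ≡⟨ cong (inside i +_) (+-identityʳ _) ⟩
      inside i + inside j                       ∎
  -- Three split copies contribute at least `2 + k` inner edges each, which together is exactly the
  -- plateau of `h (suc k)`.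
  ...     | inj₂ (l , l∈ , 1≤l) = begin
    h (suc k) (size (2 + k) X)                  ≤⟨ h-max (suc k) (size (2 + k) X) ⟩
    3 + 3 * suc k                               ≡⟨ thrice k ⟩
    (2 + k) + ((2 + k) + (2 + k))               ≤⟨ +-mono-≤ (edges≥ i 1≤i (1≤out i)) (+-mono-≤ (edges≥ j 1≤j (1≤out j)) (≤-trans (edges≥ l 1≤l (1≤out l)) (∑-term edges l∈))) ⟩
    edges i + (edges j + ∑ zs edges)            ≡⟨ cong (edges i +_) (∑-↭ edges ys↭) ⟨
    edges i + ∑ ys edges                        ≡⟨ ∑-↭ edges copies↭ ⟨
    ∑ copies edges                              ≤⟨ ∑-mono copies (λ a → m≤m+n (edges a) (row a)) ⟩
    ∑ copies (λ a → edges a + row a)            ≤⟨ boundary-slices ⟩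
    boundary (2 + k) X                          ∎
    where
    thrice : ∀ k → 3 + 3 * (1 + k) ≡ (2 + k) + ((2 + k) + (2 + k))
    thrice = solve-∀

-- If no copy is full, `no-full` applies to X; if none is empty, it applies to the complement, which
-- has the same boundary. A full copy together with an empty one gives `t` edges, at least the
-- plateau.
isoperimetric-suc : ∀ {k} → Isoperimetric k → Isoperimetric (suc k)
isoperimetric-suc {k} iso X with any? (λ i → Step.outside iso X i ≟ 0) | any? (λ i → Step.inside iso X i ≟ 0)
... | no noFull | _ =
  ≤-trans (h-mono (suc k) (m⊓n≤m (size (2 + k) X) (size (2 + k) (∁ X)))) (Step.no-full iso X (λ i → n≢0⇒n>0 (λ out≡0 → noFull (i , out≡0))))
... | yes _ | no noEmpty = begin
  h (suc k) (size (2 + k) X ⊓ size (2 + k) (∁ X)) ≤⟨ h-mono (suc k) (m⊓n≤n (size (2 + k) X) (size (2 + k) (∁ X))) ⟩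
  h (suc k) (size (2 + k) (∁ X))                  ≤⟨ Step.no-full iso (∁ X) (λ i → ≤-trans (n≢0⇒n>0 (λ in≡0 → noEmpty (i , in≡0))) (≤-reflexive (sym (size-∁∁ (suc k) (slice X i))))) ⟩
  boundary (2 + k) (∁ X)                          ≡⟨ boundary-∁ (2 + k) X ⟩
  boundary (2 + k) X                              ∎
  where open ≤-Reasoning
... | yes (i , full) | yes (j , empty) = begin
  h (suc k) (size (2 + k) X ⊓ size (2 + k) (∁ X)) ≤⟨ h-max (suc k) (size (2 + k) X ⊓ size (2 + k) (∁ X)) ⟩
  3 + 3 * suc k                                   ≡⟨ eq k ⟩
  6 + 3 * k                                       ≤⟨ 6+3k≤t k ⟩
  t (suc k) 2                                     ≤⟨ Step.full-and-empty iso X full empty ⟩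
  boundary (2 + k) X                              ∎
  where
  open ≤-Reasoning
  eq : ∀ k → 3 + 3 * (1 + k) ≡ 6 + 3 * k
  eq = solve-∀

-- The base case: vertex sets of the 6-cycle

every : ∀ n → (Vec Bool n → Bool) → Bool
every zero    P = P []
every (suc n) P = every n (P ∘ (true ∷_)) ∧ every n (P ∘ (false ∷_))

every-sound : ∀ n P → T (every n P) → ∀ v → T (P v)
every-sound zero    P ok []          = ok
every-sound (suc n) P ok (true ∷ v)  = every-sound n _ (proj₁ (Equivalence.to T-∧ ok)) v
every-sound (suc n) P ok (false ∷ v) = every-sound n _ (proj₂ (Equivalence.to (T-∧ {every n (P ∘ (true ∷_))}) ok)) v

isoperimetric-zero : Isoperimetric 0
-- The check over all 64 subsets is discharged by evaluation, the underscore standing for the unit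
-- element. `values` tabulates X in the order of `combine`, so `at values` agrees with X at each of
-- the six vertices.
isoperimetric-zero X = ≤ᵇ⇒≤ _ _ (every-sound 6 holds _ values)
  where
  at : Vec Bool 6 → V 1 2 → Bool
  at v (i , a) = lookup v (combine i a)
  holds : Vec Bool 6 → Bool
  holds v = h 0 (size 1 (at v) ⊓ size 1 (∁ (at v))) ≤ᵇ boundary 1 (at v)
  values : Vec Bool 6
  values = X (zero , zero) ∷ X (zero , suc zero) ∷ X (suc zero , zero) ∷ X (suc zero , suc zero) ∷
           X (suc (suc zero) , zero) ∷ X (suc (suc zero) , suc zero) ∷ []

isoperimetric : ∀ k → Isoperimetric k
isoperimetric zero    = isoperimetric-zero
isoperimetric (suc k) = isoperimetric-suc (isoperimetric k)

-- Edge cuts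

∂ : ∀ {k n} → (V k n → Bool) → EdgeSet k n
∂ X u v = X u ∧ not (X v)

card-∑ : ∀ k F → card k 2 F ≡ ∑ (allV k 2) λ u → ∑ (allV k 2) λ v → ⟦ (uid k 2 u <ᵇ uid k 2 v) ∧ inF k 2 F u v ⟧
card-∑ k F = ≡.trans (length-filter-T? _ (cartesianProduct (allV k 2) (allV k 2))) (∑-× _ (allV k 2) (allV k 2))

-- `boundary` orients edges out of X, `card` by increasing uid. The boundary sum is split by which
-- end has the smaller uid, the second half is transposed, and the halves are merged: at most one
-- orientation of an edge leaves X.
boundary≤card : ∀ k X F → (∀ u v → adj k 2 u v ≡ true → X u ≡ true → X v ≡ false → F u v ∨ F v u ≡ true) →
                boundary k X ≤ card k 2 F
boundary≤card k X F ∂X⊆F = begin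
  boundary k X
    ≤⟨ ∑-mono vs (λ u → ≤-trans (∑-mono vs (split u)) (≤-reflexive (∑-distrib-+ _ _ vs))) ⟩
  ∑ vs (λ u → ∑ vs (λ v → ⟦ lt u v ∧ edge u v ⟧) + ∑ vs (λ v → ⟦ lt v u ∧ edge u v ⟧))
    ≡⟨ ∑-distrib-+ _ _ vs ⟩
  ∑ vs (λ u → ∑ vs λ v → ⟦ lt u v ∧ edge u v ⟧) + ∑ vs (λ u → ∑ vs λ v → ⟦ lt v u ∧ edge u v ⟧)
    ≡⟨ cong (∑ vs (λ u → ∑ vs λ v → ⟦ lt u v ∧ edge u v ⟧) +_) (∑-swap (λ u v → ⟦ lt v u ∧ edge u v ⟧) vs vs) ⟩
  ∑ vs (λ u → ∑ vs λ v → ⟦ lt u v ∧ edge u v ⟧) + ∑ vs (λ u → ∑ vs λ v → ⟦ lt u v ∧ edge v u ⟧)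
    ≡⟨ ∑-distrib-+ _ _ vs ⟨
  ∑ vs (λ u → ∑ vs (λ v → ⟦ lt u v ∧ edge u v ⟧) + ∑ vs (λ v → ⟦ lt u v ∧ edge v u ⟧))
    ≤⟨ ∑-mono vs (λ u → ≤-trans (≤-reflexive (sym (∑-distrib-+ _ _ vs))) (∑-mono vs (merge u))) ⟩
  ∑ vs (λ u → ∑ vs λ v → ⟦ lt u v ∧ inF k 2 F u v ⟧)
    ≡⟨ card-∑ k F ⟨
  card k 2 F ∎
  where
  open ≤-Reasoning
  vs : List (V k 2)
  vs = allV k 2
  lt edge : V k 2 → V k 2 → Bool
  lt u v = uid k 2 u <ᵇ uid k 2 v
  edge u v = adj k 2 u v ∧ ∂ X u v
  split : ∀ u v → ⟦ edge u v ⟧ ≤ ⟦ lt u v ∧ edge u v ⟧ + ⟦ lt v u ∧ edge u v ⟧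
  split u v with <-cmp (uid k 2 u) (uid k 2 v)
  ... | tri< u<v _ _ rewrite <⇒<ᵇ≡true u<v = m≤m+n _ _
  ... | tri> _ _ v<u rewrite <⇒<ᵇ≡true v<u = m≤n+m _ _
  ... | tri≈ _ u≈v _ rewrite uid-injective k 2 u≈v | ∧-inverseʳ (X v) | ∧-zeroʳ (adj k 2 v v) = z≤n
  merge : ∀ u v → ⟦ lt u v ∧ edge u v ⟧ + ⟦ lt u v ∧ edge v u ⟧ ≤ ⟦ lt u v ∧ inF k 2 F u v ⟧
  merge u v with lt u v
  ... | false = z≤n
  ... | true rewrite adj-sym k 2 v u with adj k 2 u v in uv | X u in xu | X v in xv
  ...   | false | _     | _     = z≤n
  ...   | true  | false | false = z≤n
  ...   | true  | true  | true  = z≤n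
  ...   | true  | true  | false rewrite ∂X⊆F u v uv xu xv = ≤-refl
  ...   | true  | false | true  rewrite ∨-comm (F u v) (F v u) | ∂X⊆F v u (≡.trans (adj-sym k 2 v u) uv) xv xu = ≤-refl

-- The three vertices of uid 0, 1, 2; for k ≥ 1 they induce a path.
path : ∀ k → V k 2 → Bool
path k u = uid k 2 u <ᵇ 3

-- The path is an initial segment of the uids, so an edge of its cut listed with the smaller uid
-- first already points out of the path.
card-∂-path : ∀ k → card k 2 (∂ (path k)) ≤ boundary k (path k)
card-∂-path k = ≤-trans (≤-reflexive (card-∑ k (∂ (path k)))) (∑-mono (allV k 2) λ u → ∑-mono (allV k 2) (oriented u))
  where
  oriented : ∀ u v → ⟦ (uid k 2 u <ᵇ uid k 2 v) ∧ inF k 2 (∂ (path k)) u v ⟧ ≤ ⟦ adj k 2 u v ∧ ∂ (path k) u v ⟧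
  oriented u v with uid k 2 u <ᵇ uid k 2 v in u<v
  ... | false = z≤n
  ... | true with adj k 2 u v | path k u in pu | path k v in pv
  ...   | false | _     | _     = z≤n
  ...   | true  | true  | true  = z≤n
  ...   | true  | true  | false = ≤-refl
  ...   | true  | false | false = z≤n
  ...   | true  | false | true  = contradiction
    (≡.trans (sym (<⇒<ᵇ≡true {uid k 2 u} {3} (<-trans (<ᵇ≡true⇒< {uid k 2 u} {uid k 2 v} u<v) (<ᵇ≡true⇒< {uid k 2 v} {3} pv)))) pu) λ ()

size-path : ∀ k → size k (path k) ≤ 3
size-path k = begin
  size k (path k)
    ≤⟨ ∑-mono (allV k 2) (λ u → by-value (uid k 2 u)) ⟩
  ∑ (allV k 2) (λ u → at 0 u + (at 1 u + at 2 u))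
    ≡⟨ ∑-distrib-+ (at 0) _ (allV k 2) ⟩
  ∑ (allV k 2) (at 0) + ∑ (allV k 2) (λ u → at 1 u + at 2 u)
    ≡⟨ cong (∑ (allV k 2) (at 0) +_) (∑-distrib-+ (at 1) (at 2) (allV k 2)) ⟩
  ∑ (allV k 2) (at 0) + (∑ (allV k 2) (at 1) + ∑ (allV k 2) (at 2))
    ≤⟨ +-mono-≤ (one 0) (+-mono-≤ (one 1) (one 2)) ⟩
  3 ∎
  where
  open ≤-Reasoning
  at : ℕ → V k 2 → ℕ
  at c u = ⟦ uid k 2 u ≡ᵇ c ⟧
  one : ∀ c → ∑ (allV k 2) (at c) ≤ 1
  one c = ∑-⟦⟧≤1 _ (allV-unique k 2) λ u≡c v≡c → uid-injective k 2 (≡.trans (≡ᵇ≡true⇒≡ u≡c) (sym (≡ᵇ≡true⇒≡ v≡c)))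
  by-value : ∀ m → ⟦ m <ᵇ 3 ⟧ ≤ ⟦ m ≡ᵇ 0 ⟧ + (⟦ m ≡ᵇ 1 ⟧ + ⟦ m ≡ᵇ 2 ⟧)
  by-value 0 = s≤s z≤n
  by-value 1 = s≤s z≤n
  by-value 2 = s≤s z≤n
  by-value (suc (suc (suc m))) = z≤n

-- Vertices outside copy 0 have uid at least `t (suc k) 2`, which is at least 6.
path-suc : ∀ k i u → path (2 + k) (suc i , u) ≡ false
path-suc k i u = ≤⇒<ᵇ≡false (begin
  3                                            ≤⟨ m≤m+n 3 (3 + 3 * k) ⟩
  6 + 3 * k                                    ≤⟨ 6+3k≤t k ⟩
  t (suc k) 2                                  ≤⟨ m≤m+n (t (suc k) 2) _ ⟩
  suc (toℕ i) * t (suc k) 2                    ≤⟨ m≤m+n _ (uid (suc k) 2 u) ⟩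
  suc (toℕ i) * t (suc k) 2 + uid (suc k) 2 u  ∎)
  where open ≤-Reasoning

∑-allFin-suc : ∀ n (f : Fin (suc n) → ℕ) → ∑ (allFin (suc n)) f ≡ f zero + ∑ (allFin n) (f ∘ suc)
∑-allFin-suc n f = cong (f zero +_) (≡.trans (cong (λ is → ∑ is f) (sym (map-tabulate id suc))) (∑-map suc f (allFin n)))

-- From one level to the next the path stays in copy 0, and each of its at most three vertices gains
-- at most one edge to another copy, which adds 3. On the 6-cycle the value 2 is computed.
boundary-path : ∀ k → boundary (suc k) (path (suc k)) ≤ 2 + 3 * k
boundary-path zero    = ≤-refl
boundary-path (suc k) = begin
  boundary (2 + k) (path (2 + k))
    ≡⟨ ∑-× _ (allFin (suc n)) vs ⟩
  ∑ (allFin (suc n)) (λ i → ∑ vs (λ u → leaving i u))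
    ≡⟨ ∑-allFin-suc n _ ⟩
  ∑ vs (leaving zero) + ∑ (allFin n) (λ i → ∑ vs (leaving (suc i)))
    ≡⟨ cong (∑ vs (leaving zero) +_) (≡.trans (∑-cong (allFin n) λ i → ≡.trans (∑-cong vs (elsewhere i)) (∑-0 vs)) (∑-0 (allFin n))) ⟩
  ∑ vs (leaving zero) + 0
    ≡⟨ +-identityʳ _ ⟩
  ∑ vs (leaving zero)
    ≤⟨ ∑-mono vs leaving-path ⟩
  ∑ vs (λ u → ∑ vs (inner u) + ⟦ path (suc k) u ⟧)
    ≡⟨ ∑-distrib-+ _ _ vs ⟩
  boundary (suc k) (path (suc k)) + size (suc k) (path (suc k))
    ≤⟨ +-mono-≤ (boundary-path k) (size-path (suc k)) ⟩
  2 + 3 * k + 3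
    ≡⟨ eq k ⟩
  2 + 3 * suc k ∎
  where
  open ≤-Reasoning
  eq : ∀ k → 2 + 3 * k + 3 ≡ 2 + 3 * (1 + k)
  eq = solve-∀
  n : ℕ
  n = t (suc k) 2
  vs : List (V (suc k) 2)
  vs = allV (suc k) 2
  inner : V (suc k) 2 → V (suc k) 2 → ℕ
  inner u v = ⟦ adj (suc k) 2 u v ∧ ∂ (path (suc k)) u v ⟧
  edge : Fin (suc n) → V (suc k) 2 → V (2 + k) 2 → ℕ
  edge i u w = ⟦ adj (2 + k) 2 (i , u) w ∧ ∂ (path (2 + k)) (i , u) w ⟧
  leaving : Fin (suc n) → V (suc k) 2 → ℕ
  leaving i u = ∑ (allV (2 + k) 2) (edge i u)
  elsewhere : ∀ i u → leaving (suc i) u ≡ 0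
  elsewhere i u = ≡.trans (∑-cong (allV (2 + k) 2) zero-edge) (∑-0 (allV (2 + k) 2))
    where
    zero-edge : ∀ w → edge (suc i) u w ≡ 0
    zero-edge w rewrite path-suc k i u | ∧-zeroʳ (adj (2 + k) 2 (suc i , u) w) = refl
  leaving-path : ∀ u → leaving zero u ≤ ∑ vs (inner u) + ⟦ path (suc k) u ⟧
  leaving-path u with path (suc k) u in pu
  ... | false = ≤-trans (≤-reflexive (≡.trans (∑-cong (allV (2 + k) 2) zero-edge) (∑-0 (allV (2 + k) 2)))) z≤n
    where
    zero-edge : ∀ w → ⟦ adj (2 + k) 2 (zero , u) w ∧ false ⟧ ≡ 0
    zero-edge w rewrite ∧-zeroʳ (adj (2 + k) 2 (zero , u) w) = refl
  ... | true = begin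
    ∑ (allV (2 + k) 2) (λ w → ⟦ adj (2 + k) 2 (zero , u) w ∧ not (path (2 + k) w) ⟧)
      ≤⟨ ∑-mono (allV (2 + k) 2) cases ⟩
    ∑ (allV (2 + k) 2) (λ w → same w + ⟦ other w ⟧)
      ≡⟨ ∑-distrib-+ same (⟦_⟧ ∘ other) (allV (2 + k) 2) ⟩
    ∑ (allV (2 + k) 2) same + ∑ (allV (2 + k) 2) (⟦_⟧ ∘ other)
      ≤⟨ +-mono-≤ (≤-reflexive sum-same) (∑-⟦⟧≤1 other (allV-unique (2 + k) 2) other-unique) ⟩
    ∑ vs (λ v → ⟦ adj (suc k) 2 u v ∧ not (path (suc k) v) ⟧) + 1 ∎
    where
    same : V (2 + k) 2 → ℕ
    same (zero  , v) = ⟦ adj (suc k) 2 u v ∧ not (path (suc k) v) ⟧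
    same (suc _ , v) = 0
    other : V (2 + k) 2 → Bool
    other (zero  , v) = false
    other (suc j , v) = adj (2 + k) 2 (zero , u) (suc j , v)
    cases : ∀ w → ⟦ adj (2 + k) 2 (zero , u) w ∧ not (path (2 + k) w) ⟧ ≤ same w + ⟦ other w ⟧
    cases (zero  , v) = m≤m+n _ 0
    cases (suc j , v) with adj (2 + k) 2 (zero , u) (suc j , v)
    ... | false = z≤n
    ... | true  = ⟦⟧≤1 _
    sum-same : ∑ (allV (2 + k) 2) same ≡ ∑ vs (λ v → ⟦ adj (suc k) 2 u v ∧ not (path (suc k) v) ⟧)
    sum-same = ≡.trans (∑-× same (allFin (suc n)) vs) (≡.trans (∑-allFin-suc n _) (≡.trans
      (cong (∑ vs (λ v → same (zero , v)) +_) (≡.trans (∑-cong (allFin n) (λ _ → ∑-0 vs)) (∑-0 (allFin n)))) (+-identityʳ _)))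
    other-end : ∀ j v → other (suc j , v) ≡ true → uid (suc k) 2 u ≡ toℕ j × uid (suc k) 2 v ≡ 0
    -- Copy 0 has the smaller index, so only the first disjunct of `adj` survives. There the index
    -- `suc j` minus 1 is `toℕ j`, and the far end has uid 0.
    other-end j v eq with both ← ≡.trans (sym (∨-identityʳ _)) eq =
      ≡ᵇ≡true⇒≡ (∧-conicalˡ _ _ both) , ≡ᵇ≡true⇒≡ (∧-conicalʳ (uid (suc k) 2 u ≡ᵇ toℕ j) _ both)
    other-unique : ∀ {w w′} → other w ≡ true → other w′ ≡ true → w ≡ w′
    other-unique {zero  , v} {_} ()
    other-unique {suc j , v} {zero , v′} _ ()
    other-unique {suc i , v} {suc j , v′} wt wt′ with uid-u , uid-v ← other-end i v wt | uid-u′ , uid-v′ ← other-end j v′ wt′ =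
      cong₂ _,_ (cong suc (toℕ-injective (≡.trans (sym uid-u) uid-u′))) (uid-injective (suc k) 2 (≡.trans uid-v (sym uid-v′)))

-- Reachability

edgeMinus-sym : ∀ k n F u v → EdgeMinus k n F u v → EdgeMinus k n F v u
edgeMinus-sym k n F u v e = ≡.trans (cong₂ (λ a b → a ∧ not b) (adj-sym k n v u) (∨-comm (F v u) (F u v))) e

reach-trans : ∀ {k n F u v w} → Reach k n F u v → Reach k n F v w → Reach k n F u w
reach-trans u↝v here         = u↝v
reach-trans u↝v (step v↝x e) = step (reach-trans u↝v v↝x) e

reach-sym : ∀ {k n F u v} → Reach k n F u v → Reach k n F v u
reach-sym here = here
reach-sym {k} {n} {F} (step {v} {w} u↝v e) = reach-trans (step here (edgeMinus-sym k n F v w e)) (reach-sym u↝v)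

edgeMinus-∂⁺ : ∀ {k n} (X : V k n → Bool) u v → adj k n u v ≡ true → X u ≡ X v → EdgeMinus k n (∂ X) u v
edgeMinus-∂⁺ X u v uv Xu≡Xv rewrite uv | Xu≡Xv | ∧-inverseʳ (X v) = refl

edgeMinus-∂⁻ : ∀ {k n} (X : V k n → Bool) u v → EdgeMinus k n (∂ X) u v → X u ≡ X v
edgeMinus-∂⁻ {k} {n} X u v e with ∧-conicalʳ (adj k n u v) _ e
... | same with X u | X v
...   | true  | true  = refl
...   | false | false = refl

reach-∂ : ∀ {k n} (X : V k n → Bool) {u v} → Reach k n (∂ X) u v → X u ≡ X v
reach-∂ X here = refl
reach-∂ X (step {v} {w} u↝v e) = ≡.trans (reach-∂ X u↝v) (edgeMinus-∂⁻ X v w e)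

comp-path : ∀ {k n F a b c} → Unique (a ∷ b ∷ c ∷ []) → EdgeMinus k n F a b → EdgeMinus k n F b c →
            ∀ {w} → w ∈ a ∷ b ∷ c ∷ [] → CompAtLeast k n F 3 w
comp-path {k} {n} {F} {a} {b} {c} uniq ab bc w∈ =
  _ , uniq , All.map (reach-trans (reach-sym (All.lookup from-b w∈))) from-b , ≤-refl
  where
  from-b : All (Reach k n F b) (a ∷ b ∷ c ∷ [])
  from-b = step here (edgeMinus-sym k n F a b ab) ∷ here ∷ step here bc ∷ []

reach-slice : ∀ {k n} (X : V (suc k) n → Bool) i {u v} →
              Reach k n (∂ (slice X i)) u v → Reach (suc k) n (∂ X) (i , u) (i , v)
reach-slice X i here = here
reach-slice {k} {n} X i (step {v} {w} u↝v e) =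
  step (reach-slice X i u↝v) (≡.trans (cong (_∧ not (∂ X (i , v) (i , w) ∨ ∂ X (i , w) (i , v))) (adj-same k n i v w)) e)

comp-slice : ∀ {k n m} (X : V (suc k) n → Bool) i {u} →
             CompAtLeast k n (∂ (slice X i)) m u → CompAtLeast (suc k) n (∂ X) m (i , u)
comp-slice X i (xs , uniq , reach , m≤) =
  map (i ,_) xs , Unique.map⁺ (λ { refl → refl }) uniq , All.map⁺ (All.map (reach-slice X i) reach) ,
  ≤-trans m≤ (≤-reflexive (sym (length-map (i ,_) xs)))

∂-components : ∀ k (X : V (suc k) 2 → Bool) → (∀ u → X u ≡ false) ⊎ (∀ u → X u ≡ path (suc k) u) →
               ∀ u → CompAtLeast (suc k) 2 (∂ X) 3 u
∂-components (suc k) X (inj₁ ∅) (i , u) = comp-slice X i (∂-components k (slice X i) (inj₁ λ v → ∅ (i , v)) u)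
∂-components (suc k) X (inj₂ P) (zero , u) = comp-slice X zero (∂-components k (slice X zero) (inj₂ λ v → P (zero , v)) u)
∂-components (suc k) X (inj₂ P) (suc i , u) =
  comp-slice X (suc i) (∂-components k (slice X (suc i)) (inj₁ λ v → ≡.trans (P (suc i , v)) (path-suc k i v)) u)
∂-components zero X ∅⊎P = λ where
    (zero , zero)               → on-path (there (here refl))
    (zero , suc zero)           → on-path (there (there (here refl)))
    (suc zero , zero)           → on-path (here refl)
    (suc zero , suc zero)       → off-path (here refl)
    (suc (suc zero) , zero)     → off-path (there (there (here refl)))
    (suc (suc zero) , suc zero) → off-path (there (here refl))
  where
  agree : ∀ u v → path 1 u ≡ path 1 v → X u ≡ X v
  agree u v eq = [ (λ ∅ → ≡.trans (∅ u) (sym (∅ v))) , (λ P → ≡.trans (P u) (≡.trans eq (sym (P v)))) ]′ ∅⊎P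
  edge : ∀ u v → adj 1 2 u v ≡ true → path 1 u ≡ path 1 v → EdgeMinus 1 2 (∂ X) u v
  edge u v uv eq = edgeMinus-∂⁺ X u v uv (agree u v eq)
  -- The uids 2, 0, 1 and 3, 5, 4 form two disjoint paths covering the 6-cycle, and neither of them
  -- is cut.
  on-path : ∀ {w} → w ∈ (suc zero , zero) ∷ (zero , zero) ∷ (zero , suc zero) ∷ [] → CompAtLeast 1 2 (∂ X) 3 w
  on-path = comp-path (((λ ()) ∷ (λ ()) ∷ []) ∷ ((λ ()) ∷ []) ∷ [] ∷ [])
    (edge (suc zero , zero) (zero , zero) refl refl) (edge (zero , zero) (zero , suc zero) refl refl)
  off-path : ∀ {w} → w ∈ (suc zero , suc zero) ∷ (suc (suc zero) , suc zero) ∷ (suc (suc zero) , zero) ∷ [] →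
             CompAtLeast 1 2 (∂ X) 3 w
  off-path = comp-path (((λ ()) ∷ (λ ()) ∷ []) ∷ ((λ ()) ∷ []) ∷ [] ∷ [])
    (edge (suc zero , suc zero) (suc (suc zero) , suc zero) refl refl) (edge (suc (suc zero) , suc zero) (suc (suc zero) , zero) refl refl)

∂-path-restricted : ∀ k → IsRestrictedCut (suc k) 2 3 (∂ (path (suc k)))
-- Uid 3 is the first outside the path; such a vertex exists because `t` is at least 6.
∂-path-restricted k = ((node (suc k) 0 , node (suc k) 3) , separated) , ∂-components k (path (suc k)) (inj₂ λ _ → refl)
  where
  3<t : 3 < t (suc k) 2
  3<t = ≤-trans (m≤m+n 4 (2 + 3 * k)) (6+3k≤t k)
  separated : ¬ Reach (suc k) 2 (∂ (path (suc k))) (node (suc k) 0) (node (suc k) 3)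
  separated r = contradiction (≡.trans (sym (cong (_<ᵇ 3) (uid-node (suc k) (≤-<-trans z≤n 3<t))))
    (≡.trans (reach-∂ (path (suc k)) r) (cong (_<ᵇ 3) (uid-node (suc k) 3<t)))) λ ()

-- Decidable reachability and components

module Components {k} (F : EdgeSet k 2) where

  -- Joined by a walk whose inner vertices lie in the list (Warshall's recursion).
  Via : List (V k 2) → V k 2 → V k 2 → Set
  Via []       u v = u ≡ v ⊎ EdgeMinus k 2 F u v
  Via (x ∷ xs) u v = Via xs u v ⊎ (Via xs u x × Via xs x v)

  via? : ∀ xs u v → Dec (Via xs u v)
  via? []       u v = map′ (uid-injective k 2) (cong (uid k 2)) (uid k 2 u ≟ uid k 2 v) ⊎-dec (_ ≟ᵇ true)
  via? (x ∷ xs) u v = via? xs u v ⊎-dec (via? xs u x ×-dec via? xs x v)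

  via⇒reach : ∀ xs {u v} → Via xs u v → Reach k 2 F u v
  via⇒reach []       (inj₁ refl)      = here
  via⇒reach []       (inj₂ e)         = step here e
  via⇒reach (x ∷ xs) (inj₁ uv)        = via⇒reach xs uv
  via⇒reach (x ∷ xs) (inj₂ (ux , xv)) = reach-trans (via⇒reach xs ux) (via⇒reach xs xv)

  via-[] : ∀ xs {u v} → Via [] u v → Via xs u v
  via-[] []       uv = uv
  via-[] (x ∷ xs) uv = inj₁ (via-[] xs uv)

  -- Induction on the list. If the meeting point is the head, the parts before its first and after
  -- its last visit avoid it as an inner vertex. Otherwise, when both walks pass the head `y`, the
  -- detour between these visits is dropped.
  via-trans : ∀ {xs x u v} → x ∈ xs → Via xs u x → Via xs x v → Via xs u v
  via-trans {y ∷ xs} (here refl) ux xv = inj₂ (into ux , out xv)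
    where
    into : ∀ {u} → Via (y ∷ xs) u y → Via xs u y
    into (inj₁ uy)       = uy
    into (inj₂ (uy , _)) = uy
    out : ∀ {v} → Via (y ∷ xs) y v → Via xs y v
    out (inj₁ yv)       = yv
    out (inj₂ (_ , yv)) = yv
  via-trans (there x∈) (inj₁ ux)        (inj₁ xv)        = inj₁ (via-trans x∈ ux xv)
  via-trans (there x∈) (inj₁ ux)        (inj₂ (xy , yv)) = inj₂ (via-trans x∈ ux xy , yv)
  via-trans (there x∈) (inj₂ (uy , yx)) (inj₁ xv)        = inj₂ (uy , via-trans x∈ yx xv)
  via-trans (there x∈) (inj₂ (uy , _))  (inj₂ (_ , yv))  = inj₂ (uy , yv)

  reach⇒via : ∀ {u v} → Reach k 2 F u v → Via (allV k 2) u v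
  reach⇒via here = via-[] (allV k 2) (inj₁ refl)
  reach⇒via (step u↝v e) = via-trans (allV-complete k 2 _) (reach⇒via u↝v) (via-[] (allV k 2) (inj₂ e))

  -- Deciding reachability turns a component into a Boolean set, to which `size` and `boundary`
  -- apply.
  reach? : ∀ u v → Dec (Reach k 2 F u v)
  reach? u v = map′ (via⇒reach (allV k 2)) reach⇒via (via? (allV k 2) u v)

  comp : V k 2 → V k 2 → Bool
  comp u v = ⌊ reach? u v ⌋

  -- A surviving edge would extend the walk from `u` beyond its own component.
  comp-closed : ∀ u v w → adj k 2 v w ≡ true → comp u v ≡ true → comp u w ≡ false → F v w ∨ F w v ≡ true
  comp-closed u v w vw cv cw with F v w ∨ F w v in f
  ... | true  = refl
  ... | false = contradiction
    (fromWitness {a? = reach? u w} (step (toWitness {a? = reach? u v} (Equivalence.from T-≡ cv)) (cong₂ (λ a b → a ∧ not b) vw f)))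
    (subst T cw)

  -- Filtering all vertices lists the whole component, so the length of the list is its `size`; the
  -- distinct reachable vertices supplied give the opposite inequality.
  small-comp : ∀ {m u} → CompAtLeast k 2 F m u → size k (comp u) ≤ m → CompExactly k 2 F m u
  small-comp {m} {u} (ys , uniq , reach , m≤) small =
    xs , Unique.filter⁺ (T? ∘ comp u) (allV-unique k 2) ,
    All.tabulate (λ v∈ → toWitness (proj₂ (∈-filter⁻ (T? ∘ comp u) {xs = allV k 2} v∈))) ,
    ≤-antisym (≤-trans (≤-reflexive (length-filter-T? (comp u) (allV k 2))) small) m≤xs ,
    λ _ → reached
    where
    xs : List (V k 2)
    xs = filter (T? ∘ comp u) (allV k 2)
    reached : ∀ {v} → Reach k 2 F u v → v ∈ xs
    reached {v} r = ∈-filter⁺ (T? ∘ comp u) (allV-complete k 2 v) (fromWitness r)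
    m≤xs : m ≤ length xs
    m≤xs = begin
      m                ≤⟨ m≤ ⟩
      length ys        ≡⟨ length-∑ ys ⟩
      ∑ ys (λ _ → 1)   ≤⟨ ∑-⊆ (λ _ → 1) uniq (λ v∈ → reached (All.lookup reach v∈)) ⟩
      ∑ xs (λ _ → 1)   ≡⟨ length-∑ xs ⟨
      length xs        ∎
      where open ≤-Reasoning

  -- A common vertex would connect `u` to `v`. This transfers a bound on the complement of one
  -- component to another component.
  comp-disjoint : ∀ {u v} → ¬ Reach k 2 F u v → size k (comp v) ≤ size k (∁ (comp u))
  comp-disjoint {u} {v} u↝̸v = ∑-mono (allV k 2) disjoint
    where
    disjoint : ∀ w → ⟦ comp v w ⟧ ≤ ⟦ not (comp u w) ⟧
    disjoint w with reach? v w | reach? u w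
    ... | no _    | _       = z≤n
    ... | yes _   | no _    = ≤-refl
    ... | yes v↝w | yes u↝w = contradiction (reach-trans u↝w (reach-sym v↝w)) u↝̸v

-- A minimum cut measured against the path cut

theorem14 : (k : ℕ) → 2 ≤ k → SuperLambda k 2 3
theorem14 (suc k) _ F ((((u , v) , u↝̸v) , comps≥3) , minimal) =
  conclude (⊓-sel (size (suc k) (comp u)) (size (suc k) (∁ (comp u))))
  where
  open Components F
  h≤ : h k (size (suc k) (comp u) ⊓ size (suc k) (∁ (comp u))) ≤ 2 + 3 * k
  h≤ = begin
    h k (size (suc k) (comp u) ⊓ size (suc k) (∁ (comp u))) ≤⟨ isoperimetric k (comp u) ⟩
    boundary (suc k) (comp u)                               ≤⟨ boundary≤card (suc k) (comp u) F (comp-closed u) ⟩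
    card (suc k) 2 F                                        ≤⟨ minimal _ (∂-path-restricted k) ⟩
    card (suc k) 2 (∂ (path (suc k)))                       ≤⟨ card-∂-path (suc k) ⟩
    boundary (suc k) (path (suc k))                         ≤⟨ boundary-path k ⟩
    2 + 3 * k                                               ∎
    where open ≤-Reasoning
  one-side≤3 : size (suc k) (comp u) ⊓ size (suc k) (∁ (comp u)) ≤ 3
  -- `h k 4` is `3 + 3 * k`, one more than `h≤` allows.
  one-side≤3 = ≮⇒≥ λ 3< → 1+n≰n (≤-trans (h-mono k 3<) h≤)
  conclude : size (suc k) (comp u) ⊓ size (suc k) (∁ (comp u)) ≡ size (suc k) (comp u) ⊎
             size (suc k) (comp u) ⊓ size (suc k) (∁ (comp u)) ≡ size (suc k) (∁ (comp u)) →
             ∃ λ w → CompExactly (suc k) 2 F 3 w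
  conclude (inj₁ eq) = u , small-comp (comps≥3 u) (≤-trans (≤-reflexive (sym eq)) one-side≤3)
  -- The complement has at most three vertices and contains the component of `v`, which has at least
  -- three.
  conclude (inj₂ eq) = v , small-comp (comps≥3 v)
    (≤-trans (comp-disjoint u↝̸v) (≤-trans (≤-reflexive (sym eq)) one-side≤3))
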